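{- In the Game of Cycles played on the $K_4$ board (the complete graph on four vertices embedded in the plane, together with its three bounded cells), Player~2 has a winning strategy.
   Context: The Game of Cycles. A board is a simple connected planar graph embedded in the plane, together with its bounded cells (the bounded faces of the embedding). Two players alternate turns; on a turn a player marks one unmarked edge with an arrow pointing along the edge in one of its two directions. Each edge receives at most one arrow, and arrows have the same effect regardless of who placed them. Moves must obey the sink-source rule: no move may create a sink (a vertex all of whose incident edges are marked with arrows pointing toward it) or a source (a vertex all of whose incident edges are marked with arrows pointing away from it). A player who has a legal move must make one. A cycle cell is a bounded cell all of whose boundary edges are marked with arrows all cycling in the same direction (all clockwise or all counterclockwise) around that cell. The first player to create a cycle cell wins; if play ends (no legal move remains) without a cycle cell having been created, the player who made the last move wins. A winning strategy for a player is a rule for choosing moves that guarantees that player wins regardless of the opponent's moves. -}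

module Defs where

open import Data.Fin.Base using (Fin; toℕ)
open import Data.Fin.Patterns using (0F; 1F; 2F; 3F; 4F; 5F)
import Data.Fin.Properties as Fin
open import Data.List.Base using (List; []; _∷_; foldr)
open import Data.Maybe.Base using (Maybe; just; nothing)
open import Data.Nat.Base using (ℕ; zero; suc; _+_)
open import Data.Nat.GeneralisedArithmetic using (iterate)
open import Data.Product.Base using (Σ; ∃; ∃-syntax; _×_; _,_; proj₁; proj₂)
open import Data.Product.Properties using (≡-dec)
open import Data.Sum.Base using (_⊎_; inj₁; inj₂)
open import Data.Vec.Base using (Vec; lookup; replicate; _[_]≔_)
open import Function.Base using (_∘_)
open import Function.Bundles using (_⇔_; mk⇔)
open import Relation.Binary.Construct.Closure.ReflexiveTransitive using (Star; ε; _◅_)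
open import Relation.Binary.Definitions using (DecidableEquality)
open import Relation.Binary.PropositionalEquality using (_≡_; _≢_; refl; sym; trans)
open import Relation.Nullary.Decidable using (Dec; yes; no; map′; from-yes; _→-dec_; _×-dec_; _⊎-dec_; ¬?)
open import Relation.Nullary.Negation using (¬_)

data Direction : Set where
  forward backward : Direction

opposite : Direction → Direction
opposite forward  = backward
opposite backward = forward

-- Each edge gives two darts, one for each of its directions; tail and head only
-- fix which direction is called forward.
record Multigraph : Set where
  field
    #vertices #edges : ℕ
    tail head : Fin #edges → Fin #vertices

  Vertex Edge Dart : Set
  Vertex = Fin #vertices
  Edge   = Fin #edges
  Dart   = Edge × Direction

  reverse : Dart → Dart
  reverse (i , δ) = i , opposite δ

  source target : Dart → Vertex
  source (i , forward)  = tail i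
  source (i , backward) = head i
  target = source ∘ reverse

  Adjacent : Vertex → Vertex → Set
  Adjacent u w = ∃[ d ] source d ≡ u × target d ≡ w

-- A simple connected plane graph, up to homeomorphism of the plane, presented by
-- its rotation system.  Faces are the orbits of face tracing, Euler's formula
-- says that the surface is a sphere, and choosing the outer face turns the
-- sphere into the plane.  The bounded cells are the other faces.  (The
-- one-vertex graph, whose single face has no darts, is not covered.)
record Board : Set where
  field
    graph : Multigraph

  open Multigraph graph public

  field
    no-loops      : ∀ d → source d ≢ target d
    no-multiedges : ∀ d d′ → source d ≡ source d′ → target d ≡ target d′ → d ≡ d′
    connected     : ∀ u w → Star Adjacent u w

    -- The next dart clockwise around the common source vertex.
    rotate            : Dart → Dart
    rotate-source     : ∀ d → source (rotate d) ≡ source d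
    rotate-transitive : ∀ d d′ → source d ≡ source d′ → ∃[ k ] iterate rotate d k ≡ d′

  -- The dart following d on the boundary of the face to the left of d.
  next : Dart → Dart
  next d = rotate (reverse d)

  field
    #faces : ℕ

  Face : Set
  Face = Fin #faces

  field
    -- The face to the left of a dart.
    face            : Dart → Face
    face-surjective : ∀ c → ∃[ d ] face d ≡ c
    face-orbit      : ∀ d d′ → face d ≡ face d′ ⇔ (∃[ k ] iterate next d k ≡ d′)
    euler           : #vertices + #faces ≡ #edges + 2
    outer           : Face

data Player : Set where
  player₁ player₂ : Player

opponent : Player → Player
opponent player₁ = player₂
opponent player₂ = player₁

module Game (B : Board) where
  open Board B

  Position : Set
  Position = Vec (Maybe Direction) #edges

  empty : Position
  empty = replicate #edges nothing

  -- A move is a dart: the edge to be marked and the direction of its arrow.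
  mark : Dart → Position → Position
  mark (i , δ) p = p [ i ]≔ just δ

  Unmarked : Position → Dart → Set
  Unmarked p (i , _) = lookup p i ≡ nothing

  HasArrow : Position → Dart → Set
  HasArrow p (i , δ) = lookup p i ≡ just δ

  Sink Source : Position → Vertex → Set
  Sink   p v = ∀ d → target d ≡ v → HasArrow p d
  Source p v = ∀ d → source d ≡ v → HasArrow p d

  -- Every vertex has an incident edge, play starts without arrows and all earlier
  -- moves were legal, so a sink or source present after a move was created by it.
  Legal : Position → Dart → Set
  Legal p d = Unmarked p d × (∀ v → ¬ Sink (mark d p) v) × (∀ v → ¬ Source (mark d p) v)

  -- The darts with c on their left run counterclockwise around the bounded
  -- cell c; the two alternatives are counterclockwise and clockwise.
  CycleCell : Position → Face → Set
  CycleCell p c = c ≢ outer ×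
    ((∀ d → face d ≡ c → HasArrow p d) ⊎ (∀ d → face d ≡ c → HasArrow p (reverse d)))

  HasCycleCell : Position → Set
  HasCycleCell p = ∃[ c ] CycleCell p c

  Stuck : Position → Set
  Stuck p = ∀ d → ¬ Legal p d

  -- The moves made so far, most recent first.
  History : Set
  History = List Dart

  position : History → Position
  position = foldr mark empty

  toMove : History → Player
  toMove []      = player₁
  toMove (_ ∷ h) = opponent (toMove h)

  -- Histories that obey the rules; play stops once a cycle cell exists.
  data Play : History → Set where
    []  : Play []
    _∷_ : ∀ {d h} → ¬ HasCycleCell (position h) × Legal (position h) d →
          Play h → Play (d ∷ h)

  Over : History → Set
  Over h = HasCycleCell (position h) ⊎ Stuck (position h)

  -- In both cases toMove h is the player who made the last move d.
  data WonBy (P : Player) : History → Set where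
    by-cycle-cell : ∀ {d h} → toMove h ≡ P → ¬ HasCycleCell (position h) →
                    HasCycleCell (position (d ∷ h)) → WonBy P (d ∷ h)
    by-last-move  : ∀ {d h} → toMove h ≡ P → ¬ HasCycleCell (position (d ∷ h)) →
                    Stuck (position (d ∷ h)) → WonBy P (d ∷ h)

  -- Only the values at histories where it is the strategy owner's turn and
  -- play is not over matter.
  Strategy : Set
  Strategy = History → Dart

  data Follows (P : Player) (σ : Strategy) : History → Set where
    []  : Follows P σ []
    _∷_ : ∀ {d h} → (toMove h ≡ P → d ≡ σ h) → Follows P σ h → Follows P σ (d ∷ h)

  -- Every play is finite, since each move marks a new edge, so it is enough to
  -- require that σ always supplies a legal move when its owner has to move and
  -- that all finished plays are won.
  Winning : Player → Strategy → Set
  Winning P σ = ∀ h → Play h → Follows P σ h →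
    (toMove h ≡ P → ¬ Over h → Legal (position h) (σ h)) × (Over h → WonBy P h)

HasWinningStrategy : Board → Player → Set
HasWinningStrategy B P = ∃[ σ ] Winning P σ
  where open Game B

private
  _≟ᵈ_ : DecidableEquality Direction
  forward  ≟ᵈ forward  = yes refl
  forward  ≟ᵈ backward = no λ ()
  backward ≟ᵈ forward  = no λ ()
  backward ≟ᵈ backward = yes refl

  module _ {n : ℕ} where

    _≟_ : DecidableEquality (Fin n × Direction)
    _≟_ = ≡-dec Fin._≟_ _≟ᵈ_

    all-darts? : {P : Fin n × Direction → Set} → (∀ d → Dec (P d)) → Dec (∀ d → P d)
    all-darts? P? = map′
      (λ { f (i , forward) → proj₁ (f i) ; f (i , backward) → proj₂ (f i) })
      (λ f i → f (i , forward) , f (i , backward))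
      (Fin.all? λ i → P? (i , forward) ×-dec P? (i , backward))

    any-dart? : {P : Fin n × Direction → Set} → (∀ d → Dec (P d)) → Dec (∃ P)
    any-dart? P? = map′
      (λ { (i , inj₁ p) → (i , forward) , p ; (i , inj₂ p) → (i , backward) , p })
      (λ { ((i , forward) , p) → i , inj₁ p ; ((i , backward) , p) → i , inj₂ p })
      (Fin.any? λ i → P? (i , forward) ⊎-dec P? (i , backward))

-- K₄ is drawn with vertices 0, 1, 2 counterclockwise on the outer triangle and
-- vertex 3 inside it.  Up to relabelling and homeomorphism this is the only
-- embedding of K₄ in the plane.
module K₄-construction where

  tail head : Fin 6 → Fin 4
  tail 0F = 0F
  tail 1F = 1F
  tail 2F = 2F
  tail 3F = 0F
  tail 4F = 1F
  tail 5F = 2F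

  head 0F = 1F
  head 1F = 2F
  head 2F = 0F
  head 3F = 3F
  head 4F = 3F
  head 5F = 3F

  graph : Multigraph
  graph = record { tail = tail ; head = head }

  open Multigraph graph using (Dart; reverse; source; target; Adjacent)

  no-loops : ∀ d → source d ≢ target d
  no-loops = from-yes (all-darts? λ d → ¬? (source d Fin.≟ target d))

  no-multiedges : ∀ d d′ → source d ≡ source d′ → target d ≡ target d′ → d ≡ d′
  no-multiedges = from-yes (all-darts? λ d → all-darts? λ d′ →
    (source d Fin.≟ source d′) →-dec (target d Fin.≟ target d′) →-dec (d ≟ d′))

  complete : ∀ u w → u ≢ w → Adjacent u w
  complete = from-yes (Fin.all? λ u → Fin.all? λ w → ¬? (u Fin.≟ w) →-dec
    any-dart? λ d → (source d Fin.≟ u) ×-dec (target d Fin.≟ w))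

  connected : ∀ u w → Star Adjacent u w
  connected u w with u Fin.≟ w
  ... | yes refl = ε
  ... | no  u≢w  = complete u w u≢w ◅ ε

  -- Clockwise neighbour orders: (1 2 3) at 0, (0 3 2) at 1, (0 1 3) at 2 and
  -- (0 2 1) at 3.
  rotate : Dart → Dart
  rotate (0F , forward)  = 2F , backward
  rotate (2F , backward) = 3F , forward
  rotate (3F , forward)  = 0F , forward
  rotate (0F , backward) = 4F , forward
  rotate (4F , forward)  = 1F , forward
  rotate (1F , forward)  = 0F , backward
  rotate (2F , forward)  = 1F , backward
  rotate (1F , backward) = 5F , forward
  rotate (5F , forward)  = 2F , forward
  rotate (3F , backward) = 5F , backward
  rotate (5F , backward) = 4F , backward
  rotate (4F , backward) = 3F , backward

  next : Dart → Dart
  next d = rotate (reverse d)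

  -- Faces 0, 1, 2 are the triangles 0 1 3, 1 2 3 and 2 0 3; face 3 is the
  -- unbounded one.
  face : Dart → Fin 4
  face (0F , forward)  = 0F
  face (4F , forward)  = 0F
  face (3F , backward) = 0F
  face (1F , forward)  = 1F
  face (5F , forward)  = 1F
  face (4F , backward) = 1F
  face (2F , forward)  = 2F
  face (3F , forward)  = 2F
  face (5F , backward) = 2F
  face (0F , backward) = 3F
  face (1F , backward) = 3F
  face (2F , backward) = 3F

  rotate-source : ∀ d → source (rotate d) ≡ source d
  rotate-source = from-yes (all-darts? λ d → source (rotate d) Fin.≟ source d)

  rotate-transitive : ∀ d d′ → source d ≡ source d′ → ∃[ k ] iterate rotate d k ≡ d′
  rotate-transitive d d′ eq = let k , p = bounded d d′ eq in toℕ k , p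
    where
    bounded : ∀ d d′ → source d ≡ source d′ → Σ (Fin 3) λ k → iterate rotate d (toℕ k) ≡ d′
    bounded = from-yes (all-darts? λ d → all-darts? λ d′ →
      (source d Fin.≟ source d′) →-dec Fin.any? {n = 3} λ k → iterate rotate d (toℕ k) ≟ d′)

  face-surjective : ∀ c → ∃[ d ] face d ≡ c
  face-surjective = from-yes (Fin.all? λ c → any-dart? λ d → face d Fin.≟ c)

  face-orbit : ∀ d d′ → face d ≡ face d′ ⇔ (∃[ k ] iterate next d k ≡ d′)
  face-orbit d d′ = mk⇔
    (λ eq → let k , p = bounded d d′ eq in toℕ k , p)
    (λ { (k , refl) → sym (iterate-face k d) })
    where
    bounded : ∀ d d′ → face d ≡ face d′ → Σ (Fin 3) λ k → iterate next d (toℕ k) ≡ d′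
    bounded = from-yes (all-darts? λ d → all-darts? λ d′ →
      (face d Fin.≟ face d′) →-dec Fin.any? {n = 3} λ k → iterate next d (toℕ k) ≟ d′)

    next-face : ∀ d → face (next d) ≡ face d
    next-face = from-yes (all-darts? λ d → face (next d) Fin.≟ face d)

    iterate-face : ∀ k d → face (iterate next d k) ≡ face d
    iterate-face zero    d = refl
    iterate-face (suc k) d = trans (iterate-face k (next d)) (next-face d)

K₄ : Board
K₄ = record
  { graph             = graph
  ; no-loops          = no-loops
  ; no-multiedges     = no-multiedges
  ; connected         = connected
  ; rotate            = rotate
  ; rotate-source     = rotate-source
  ; rotate-transitive = rotate-transitive
  ; face              = face
  ; face-surjective   = face-surjective
  ; face-orbit        = face-orbit
  ; euler             = refl
  ; outer             = 3F
  }
  where open K₄-construction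

{-# OPTIONS --safe #-}
-- The edges of K₄ form three pairs of opposite edges, and every triangle contains
-- one edge of each pair.  Player 2 answers the first arrow on the opposite edge,
-- so no cell then has two arrows and Player 1 cannot close a cycle.  From then on
-- Player 2 closes a cycle cell whenever possible and otherwise plays a move after
-- which Player 1 cannot close one.  That this wins is checked on all plays.
module Submission where

open import Data.Fin.Base using (Fin)
open import Data.Fin.Patterns using (0F; 1F; 2F; 3F; 4F; 5F)
import Data.Fin.Properties as Fin
open import Data.List.Base using (List; []; _∷_; _++_; allFin; cartesianProduct; filter; head)
open import Data.Maybe.Base using (fromMaybe)
import Data.Maybe.Properties as Maybe
open import Data.Nat.Base using (ℕ; zero; suc)
open import Data.Product.Base using (∃; _×_; _,_; proj₁; proj₂)
open import Data.Sum.Base using (_⊎_; inj₁; inj₂)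
open import Data.Vec.Base using (lookup)
open import Relation.Binary.Definitions using (DecidableEquality)
open import Relation.Binary.PropositionalEquality using (_≡_; _≢_; refl; subst; sym)
open import Relation.Nullary.Decidable
  using (Dec; yes; no; map′; from-yes; _→-dec_; _×-dec_; _⊎-dec_; ¬?)
open import Relation.Nullary.Negation using (¬_; contradiction)
open import Defs

_≟ᵈ_ : DecidableEquality Direction
forward  ≟ᵈ forward  = yes refl
forward  ≟ᵈ backward = no λ ()
backward ≟ᵈ forward  = no λ ()
backward ≟ᵈ backward = yes refl

_≟ᵖ_ : DecidableEquality Player
player₁ ≟ᵖ player₁ = yes refl
player₁ ≟ᵖ player₂ = no λ ()
player₂ ≟ᵖ player₁ = no λ ()
player₂ ≟ᵖ player₂ = yes refl

module DecidableGame (B : Board) where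
  open Board B hiding (head)
  open Game B

  all-darts? : {P : Dart → Set} → (∀ d → Dec (P d)) → Dec (∀ d → P d)
  all-darts? P? = map′
    (λ { f (i , forward) → proj₁ (f i) ; f (i , backward) → proj₂ (f i) })
    (λ f i → f (i , forward) , f (i , backward))
    (Fin.all? λ i → P? (i , forward) ×-dec P? (i , backward))

  darts : List Dart
  darts = cartesianProduct (allFin #edges) (forward ∷ backward ∷ [])

  hasArrow? : ∀ p d → Dec (HasArrow p d)
  hasArrow? p (i , δ) = Maybe.≡-dec _≟ᵈ_ (lookup p i) _

  unmarked? : ∀ p d → Dec (Unmarked p d)
  unmarked? p (i , _) = Maybe.≡-dec _≟ᵈ_ (lookup p i) _

  sink? : ∀ p v → Dec (Sink p v)
  sink? p v = all-darts? λ d → (target d Fin.≟ v) →-dec hasArrow? p d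

  source? : ∀ p v → Dec (Source p v)
  source? p v = all-darts? λ d → (source d Fin.≟ v) →-dec hasArrow? p d

  legal? : ∀ p d → Dec (Legal p d)
  legal? p d = unmarked? p d
    ×-dec (Fin.all? λ v → ¬? (sink? (mark d p) v))
    ×-dec (Fin.all? λ v → ¬? (source? (mark d p) v))

  hasCycleCell? : ∀ p → Dec (HasCycleCell p)
  hasCycleCell? p = Fin.any? λ c → ¬? (c Fin.≟ outer) ×-dec
    ((all-darts? λ d → (face d Fin.≟ c) →-dec hasArrow? p d) ⊎-dec
     (all-darts? λ d → (face d Fin.≟ c) →-dec hasArrow? p (reverse d)))

  stuck? : ∀ p → Dec (Stuck p)
  stuck? p = all-darts? λ d → ¬? (legal? p d)

  over? : ∀ h → Dec (Over h)
  over? h = hasCycleCell? (position h) ⊎-dec stuck? (position h)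

  wonBy? : ∀ P h → Dec (WonBy P h)
  wonBy? P []      = no λ ()
  wonBy? P (d ∷ h) = map′
    (λ { (t , inj₁ (n , c)) → by-cycle-cell t n c ; (t , inj₂ (n , s)) → by-last-move t n s })
    (λ { (by-cycle-cell t n c) → t , inj₁ (n , c) ; (by-last-move t n s) → t , inj₂ (n , s) })
    ((toMove h ≟ᵖ P) ×-dec
      ((¬? (hasCycleCell? (position h)) ×-dec hasCycleCell? (position (d ∷ h))) ⊎-dec
       (¬? (hasCycleCell? (position (d ∷ h))) ×-dec stuck? (position (d ∷ h)))))

  wonBy⇒over : ∀ {P h} → WonBy P h → Over h
  wonBy⇒over (by-cycle-cell _ _ c) = inj₁ c
  wonBy⇒over (by-last-move _ _ s)  = inj₂ s

  Completing : Position → Dart → Set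
  Completing p d = Legal p d × HasCycleCell (mark d p)

  completing? : ∀ p d → Dec (Completing p d)
  completing? p d = legal? p d ×-dec hasCycleCell? (mark d p)

  Safe : Position → Dart → Set
  Safe p d = Legal p d × (∀ d′ → ¬ Completing (mark d p) d′)

  safe? : ∀ p d → Dec (Safe p d)
  safe? p d = legal? p d ×-dec all-darts? λ d′ → ¬? (completing? (mark d p) d′)

  cautious : (Dart → Dart) → Dart → Strategy
  cautious answer default []      = default
  -- The order of concatenation is the order of priority. The reply `answer d` to the latest move
  -- leads the safe moves, and the remaining choice is settled by the order of `darts`. Falling back
  -- on `default` makes this total; whether the chosen dart is legal is checked only in
  -- `WinsWithin`.
  cautious answer default (d ∷ h) = fromMaybe default
    (head (filter (completing? p) darts ++ filter (safe? p) (answer d ∷ darts)))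
    where p = position (d ∷ h)

  module _ (P : Player) (σ : Strategy) where

    -- A game tree with one branch at the turns of `P` and a branch for every legal move at the
    -- other turns. The depth bound makes it decidable by recursion; a branch that exhausts the
    -- bound must already be won.
    WinsWithin : ℕ → History → Set
    WinsWithin zero    h = WonBy P h
    WinsWithin (suc n) h = WonBy P h ⊎ ¬ Over h ×
      (toMove h ≡ P → Legal (position h) (σ h) × WinsWithin n (σ h ∷ h)) ×
      (toMove h ≢ P → ∀ d → Legal (position h) d → WinsWithin n (d ∷ h))

    winsWithin? : ∀ n h → Dec (WinsWithin n h)
    winsWithin? zero    h = wonBy? P h
    winsWithin? (suc n) h = wonBy? P h ⊎-dec ¬? (over? h) ×-dec
      ((toMove h ≟ᵖ P) →-dec (legal? (position h) (σ h) ×-dec winsWithin? n (σ h ∷ h))) ×-dec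
      (¬? (toMove h ≟ᵖ P) →-dec
        all-darts? λ d → legal? (position h) d →-dec winsWithin? n (d ∷ h))

    -- A won history is over, so no play continues beyond it. This rules out leaves of the tree in
    -- the descent below.
    legal⇒¬wonBy : ∀ {d h} → ¬ HasCycleCell (position h) → Legal (position h) d → ¬ WonBy P h
    legal⇒¬wonBy ¬c l w with wonBy⇒over w
    ... | inj₁ c = ¬c c
    ... | inj₂ s = s _ l

    -- Induction on the play: each move descends one level of the tree, and a leaf cannot be left by
    -- a further move. The depth `m` that remains depends on the length of the play.
    winsWithin-play : ∀ {n h} → WinsWithin n [] → Play h → Follows P σ h → ∃ λ m → WinsWithin m h
    winsWithin-play {n} w [] [] = n , w
    winsWithin-play {h = _ ∷ h} w ((¬c , l) ∷ play) (f ∷ follows) with winsWithin-play w play follows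
    ... | zero  , won      = contradiction won (legal⇒¬wonBy ¬c l)
    ... | suc m , inj₁ won = contradiction won (legal⇒¬wonBy ¬c l)
    ... | suc m , inj₂ (_ , own , other) with toMove h ≟ᵖ P
    -- The tree only contains the branch of `σ h`; `f t` identifies the move played with it.
    ...   | yes t = m , subst (λ e → WinsWithin m (e ∷ h)) (sym (f t)) (proj₂ (own t))
    ...   | no ¬t = m , other ¬t _ l

    -- A leaf is over and an inner node is not, so at each node one of the two conditions is
    -- vacuous.
    winsWithin⇒sound : ∀ n {h} → WinsWithin n h →
      (toMove h ≡ P → ¬ Over h → Legal (position h) (σ h)) × (Over h → WonBy P h)
    winsWithin⇒sound zero    won =
      (λ _ ¬o → contradiction (wonBy⇒over won) ¬o) , λ _ → won
    winsWithin⇒sound (suc n) (inj₁ won)           = winsWithin⇒sound zero won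
    winsWithin⇒sound (suc n) (inj₂ (¬o , own , _)) =
      (λ t _ → proj₁ (own t)) , λ o → contradiction o ¬o

    winsWithin⇒winning : ∀ n → WinsWithin n [] → Winning P σ
    winsWithin⇒winning n w h play follows =
      let m , w′ = winsWithin-play {n} w play follows in winsWithin⇒sound m w′

-- The three perfect matchings of K₄: each outer side is paired with the spoke from the third outer
-- vertex.
opposite-edge : Fin 6 → Fin 6
opposite-edge 0F = 5F
opposite-edge 1F = 3F
opposite-edge 2F = 4F
opposite-edge 3F = 1F
opposite-edge 4F = 2F
opposite-edge 5F = 0F

open DecidableGame K₄

strategy : Game.Strategy K₄
-- Keeping `δ` answers a counterclockwise outer arrow by a spoke arrow towards the centre, and
-- conversely.
strategy = cautious (λ { (i , δ) → opposite-edge i , δ }) (0F , forward)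

theorem4p1 : HasWinningStrategy K₄ player₂
theorem4p1 = strategy ,
  -- Each move marks a new one of the 6 edges, so depth 6 covers every play.
  winsWithin⇒winning player₂ strategy 6 (from-yes (winsWithin? player₂ strategy 6 []))
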